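{- Let $n$ and $k$ be positive integers with $k>1$ and $n\geqslant k(k+1)$. Then the Roman domination number of the Kneser graph $K_{n,k}$ satisfies $\gamma_{R}(K_{n,k}) = 2(k+1)$.
   Context: For positive integers $n,k$, the Kneser graph $K_{n,k}$ is the simple graph whose vertices are all $k$-element subsets of $\{1,2,\dots,n\}$, two vertices being adjacent if and only if the corresponding sets are disjoint. Let $G=(V,E)$ be a finite simple graph. A Roman domination function (RDF) on $G$ is a function $f:V\to\{0,1,2\}$ such that every vertex $v$ with $f(v)=0$ has a neighbor $u$ with $f(u)=2$. The weight of $f$ is $f(V)=\sum_{v\in V}f(v)$. The Roman domination number $\gamma_{R}(G)$ is the minimum weight over all RDFs on $G$. -}

module Defs where

open import Data.Bool using (true; false)
open import Data.Empty using (⊥)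
open import Data.Fin using (Fin; toℕ)
open import Data.Fin.Patterns using (0F; 2F)
open import Data.Fin.Subset using (Subset; inside; outside; ∣_∣; _∩_; Empty)
open import Data.Fin.Subset.Properties using (∩-comm; ∩-idem; Empty-unique; ∣⊥∣≡0)
open import Data.List using (List; []; _∷_; [_]; _++_; map; sum)
open import Data.List.Membership.Propositional using (_∈_)
open import Data.List.Membership.Propositional.Properties
  using (∈-map⁺; ∈-map⁻; ∈-++⁺ˡ; ∈-++⁺ʳ)
open import Data.List.Relation.Unary.All as All using ()
open import Data.List.Relation.Unary.AllPairs as AllPairs using ()
open import Data.List.Relation.Unary.Any using (here)
open import Data.List.Relation.Unary.Unique.Propositional using (Unique)
open import Data.List.Relation.Unary.Unique.Propositional.Properties using (map⁺; ++⁺)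
open import Data.Nat using (ℕ; zero; suc; _≤_; NonZero)
open import Data.Nat.Properties using (1+n≢0; ≡-irrelevant; suc-injective; ≤-antisym)
open import Data.Product using (Σ; ∃; _×_; _,_; proj₁)
open import Data.Vec using ([]; _∷_)
open import Data.Vec.Properties using (∷-injectiveʳ)
open import Function using (_∘_)
open import Level using (0ℓ)
open import Relation.Binary using (Rel; Symmetric; Irreflexive)
open import Relation.Binary.PropositionalEquality
  using (_≡_; refl; sym; trans; cong; subst)

record FiniteSimpleGraph : Set₁ where
  infix 4 _~_
  field
    Vertex   : Set
    _~_      : Rel Vertex 0ℓ
    ~-sym    : Symmetric _~_
    ~-irrefl : Irreflexive _≡_ _~_
    -- Finiteness: every vertex is listed exactly once, so that a sum
    -- over this list is a sum over the vertex set.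
    vertices : List Vertex
    complete : ∀ v → v ∈ vertices
    unique   : Unique vertices

module _ (G : FiniteSimpleGraph) where
  open FiniteSimpleGraph G

  IsRDF : (Vertex → Fin 3) → Set
  IsRDF f = ∀ v → f v ≡ 0F → ∃ λ u → v ~ u × f u ≡ 2F

  weight : (Vertex → Fin 3) → ℕ
  weight f = sum (map (toℕ ∘ f) vertices)

  -- m is the minimum of the weights of the RDFs on G: it is attained,
  -- and it is a lower bound.
  IsRomanDominationNumber : ℕ → Set
  IsRomanDominationNumber m =
    (∃ λ f → IsRDF f × weight f ≡ m) × (∀ f → IsRDF f → m ≤ weight f)

  romanDominationNumber-unique : ∀ {m m′} →
    IsRomanDominationNumber m → IsRomanDominationNumber m′ → m ≡ m′
  romanDominationNumber-unique ((f , rf , refl) , lb) ((g , rg , refl) , lb′) =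
    ≤-antisym (lb g rg) (lb′ f rf)

KSubset : ℕ → ℕ → Set
KSubset n k = Σ (Subset n) λ p → ∣ p ∣ ≡ k

KSubset-≡ : ∀ {n k} {x y : KSubset n k} → proj₁ x ≡ proj₁ y → x ≡ y
KSubset-≡ {x = p , e} {y = .p , e′} refl = cong (p ,_) (≡-irrelevant e e′)

skip : ∀ {n k} → KSubset n k → KSubset (suc n) k
skip (p , e) = outside ∷ p , e

keep : ∀ {n k} → KSubset n k → KSubset (suc n) (suc k)
keep (p , e) = inside ∷ p , cong suc e

kSubsets : ∀ n k → List (KSubset n k)
kSubsets zero    zero    = [ [] , refl ]
kSubsets zero    (suc k) = []
kSubsets (suc n) zero    = map skip (kSubsets n zero)
kSubsets (suc n) (suc k) = map skip (kSubsets n (suc k)) ++ map keep (kSubsets n k)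

kSubsets-complete : ∀ n k (x : KSubset n k) → x ∈ kSubsets n k
kSubsets-complete zero    zero    ([] , refl) = here refl
kSubsets-complete (suc n) zero    (false ∷ p , e) =
  ∈-map⁺ skip (kSubsets-complete n zero (p , e))
kSubsets-complete (suc n) (suc k) (false ∷ p , e) =
  ∈-++⁺ˡ (∈-map⁺ skip (kSubsets-complete n (suc k) (p , e)))
kSubsets-complete (suc n) (suc k) (true ∷ p , e) =
  ∈-++⁺ʳ (map skip (kSubsets n (suc k)))
    (subst (_∈ map keep (kSubsets n k)) (KSubset-≡ refl)
      (∈-map⁺ keep (kSubsets-complete n k (p , suc-injective e))))

skip-injective : ∀ {n k} {x y : KSubset n k} → skip x ≡ skip y → x ≡ y
skip-injective eq = KSubset-≡ (∷-injectiveʳ (cong proj₁ eq))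

keep-injective : ∀ {n k} {x y : KSubset n k} → keep x ≡ keep y → x ≡ y
keep-injective eq = KSubset-≡ (∷-injectiveʳ (cong proj₁ eq))

kSubsets-unique : ∀ n k → Unique (kSubsets n k)
kSubsets-unique zero    zero    = All.[] AllPairs.∷ AllPairs.[]
kSubsets-unique zero    (suc k) = AllPairs.[]
kSubsets-unique (suc n) zero    = map⁺ skip-injective (kSubsets-unique n zero)
kSubsets-unique (suc n) (suc k) =
  ++⁺ (map⁺ skip-injective (kSubsets-unique n (suc k)))
      (map⁺ keep-injective (kSubsets-unique n k))
      λ (v∈skip , v∈keep) → disjoint (∈-map⁻ skip v∈skip) (∈-map⁻ keep v∈keep)
  where
  disjoint : ∀ {v} →
    ∃ (λ x → x ∈ kSubsets n (suc k) × v ≡ skip x) →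
    ∃ (λ y → y ∈ kSubsets n k × v ≡ keep y) → ⊥
  disjoint (x , _ , refl) (y , _ , eq) with () ← cong proj₁ eq

Disjoint : ∀ {n k} → Rel (KSubset n k) 0ℓ
Disjoint (p , _) (q , _) = Empty (p ∩ q)

Disjoint-sym : ∀ {n k} → Symmetric (Disjoint {n} {k})
Disjoint-sym {x = p , _} {y = q , _} = subst Empty (∩-comm p q)

-- Needs k ≠ 0, since the empty set is disjoint from itself.
Disjoint-irrefl : ∀ {n k} .{{_ : NonZero k}} → Irreflexive _≡_ (Disjoint {n} {k})
Disjoint-irrefl {n} {suc k} {x = p , e} refl p∩p-empty =
  1+n≢0 (trans (sym e) (trans (cong ∣_∣ p≡⊥) (∣⊥∣≡0 n)))
  where p≡⊥ = Empty-unique (subst Empty (∩-idem p) p∩p-empty)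

Kneser : ∀ n k .{{_ : NonZero n}} .{{_ : NonZero k}} → FiniteSimpleGraph
Kneser n k = record
  { Vertex   = KSubset n k
  ; _~_      = Disjoint
  ; ~-sym    = λ {x} {y} → Disjoint-sym {x = x} {y = y}
  ; ~-irrefl = Disjoint-irrefl
  ; vertices = kSubsets n k
  ; complete = kSubsets-complete n k
  ; unique   = kSubsets-unique n k
  }

{-# OPTIONS --safe #-}

-- Upper bound: give the value 2 to k + 1 pairwise disjoint k-sets, which fit
-- since n ≥ k (k + 1).  A k-set cannot meet all of them.
--
-- Lower bound: let m be the number of vertices of value 2.  A k-set meeting
-- all of these has nonzero value.  If m > k, the weight is already large
-- enough.  If m = 0, every vertex has nonzero value.  If some set T of k - 1
-- elements meets all m sets, then the n - k + 1 many k-sets containing T have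
-- nonzero value, and the m sets of value 2 contribute a further 1 each.
-- Otherwise m = k and the m sets are pairwise disjoint, as an element common to
-- two of them would give such a T.  Now two transversals differing in the
-- element chosen from the first set are vertices of nonzero value that are not
-- among the m sets, so the weight is at least 2 k + 2.
module Submission where

open import Defs
open import Data.Bool.Properties using () renaming (_≟_ to _≟ᵇ_)
open import Data.Empty using (⊥-elim)
open import Data.Fin using (Fin; toℕ; zero; suc)
open import Data.Fin.Patterns using (0F; 1F; 2F)
open import Data.Fin.Properties as Finₚ using (toℕ≤pred[n]) renaming (_≟_ to _≟ᶠ_)
open import Data.Fin.Subset
  using (Subset; inside; outside; ∣_∣; _∩_; _∪_; ∁; ⊥; ⁅_⁆; _-_; Nonempty; _⊆_)
  renaming (_∈_ to _∈ₛ_)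
open import Data.Fin.Subset.Properties
  using (x∈p∩q⁺; x∈p∩q⁻; x∈p∪q⁺; x∈p∪q⁻; x∈⁅x⁆; x∈⁅y⁆⇒x≡y; ∣⁅x⁆∣≡1; p⊆p∪q; q⊆p∪q;
         ∩-comm; ∣⊥∣≡0; ⊥⊆; ∣∁p∣≡n∸∣p∣; x∈∁p⇒x∉p; p⊆q⇒∣p∣≤∣q∣;
         x∈p⇒∣p-x∣<∣p∣; x∈p∧x≢y⇒x∈p-y; nonempty?; ∈⊤; ∣⊤∣≡n;
         drop-∷-⊆; s⊆s; out⊆; ⊆-refl)
open import Data.List using (List; []; _∷_; _++_; map; length; filter)
open import Data.List.Properties using (length-map; length-++)
open import Data.List.Membership.Propositional using (_∈_; _∉_; find; lose)
open import Data.List.Membership.Propositional.Properties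
  using (∈-∃++; ∈-++⁻; ∈-++⁺ˡ; ∈-++⁺ʳ; ∈-filter⁺; ∈-map⁻)
open import Data.List.Membership.DecPropositional using () renaming (_∈?_ to member?)
open import Data.List.Relation.Unary.All as All using (All; []; _∷_)
open import Data.List.Relation.Unary.All.Properties as Allₚ using (¬Any⇒All¬)
open import Data.List.Relation.Unary.AllPairs using (AllPairs; []; _∷_)
open import Data.List.Relation.Unary.Any using (Any; here; there; any?)
open import Data.List.Relation.Unary.Unique.Propositional using (Unique)
open import Data.List.Relation.Unary.Unique.Propositional.Properties
  using (map⁺; filter⁺)
open import Data.List.Relation.Binary.Permutation.Propositional.Properties as ↭
  using (shift)
open import Data.Nat using (ℕ; zero; suc; _+_; _*_; _∸_; _⊓_; _≤_; _<_; _>_; _≥_; z≤n; s≤s; z<s; pred;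
  NonZero; >-nonZero⁻¹)
open import Data.Nat.ListAction using (sum)
open import Data.Nat.ListAction.Properties using (sum-↭)
open import Data.Nat.Properties
open import Data.Nat.Tactic.RingSolver using (solve-∀)
open import Data.Product using (∃; ∃₂; _×_; _,_; proj₁; proj₂)
open import Data.Sum using (_⊎_; inj₁; inj₂; [_,_]′)
open import Data.Vec as Vec using ([]; _∷_)
open import Data.Vec.Properties using (≡-dec)
open import Function using (_∘_; id)
open import Relation.Nullary using (Dec; yes; no; ¬_; contradiction)
open import Relation.Nullary.Decidable using (map′; ¬?; decidable-stable)
open import Relation.Binary.Definitions using (DecidableEquality)
open import Relation.Binary.PropositionalEquality
  using (_≡_; _≢_; refl; sym; trans; cong; subst)

-- Sums over lists.

module _ {A : Set} where

  -- Each `x` in `xs` with `g x ≢ 0` is cancelled against one occurrence in `ys`; as `xs` has no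
  -- repetitions, the rest of its support survives in what remains of `ys`. This gives both the
  -- bound of a partial sum by the full sum and the bound of a full sum by the sum over a support.
  sum-support-≤ : ∀ (g : A → ℕ) {xs} ys → Unique xs →
    (∀ {x} → x ∈ xs → g x ≢ 0 → x ∈ ys) → sum (map g xs) ≤ sum (map g ys)
  sum-support-≤ g {[]}     ys _ _ = z≤n
  sum-support-≤ g {x ∷ xs} ys (x∉xs ∷ uniq) supp with g x ≟ 0
  ... | yes gx≡0 = subst (λ a → a + sum (map g xs) ≤ sum (map g ys)) (sym gx≡0)
                     (sum-support-≤ g ys uniq (supp ∘ there))
  ... | no  gx≢0 with ∈-∃++ (supp (here refl) gx≢0)
  ...   | as , bs , refl = begin
    g x + sum (map g xs)          ≤⟨ +-monoʳ-≤ (g x) (sum-support-≤ g (as ++ bs) uniq supp′) ⟩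
    g x + sum (map g (as ++ bs))  ≡⟨ sum-↭ (↭.map⁺ g (shift x as bs)) ⟨
    sum (map g (as ++ x ∷ bs))    ∎
    where
    open ≤-Reasoning
    supp′ : ∀ {y} → y ∈ xs → g y ≢ 0 → y ∈ as ++ bs
    supp′ y∈xs gy≢0 with ∈-++⁻ as (supp (there y∈xs) gy≢0)
    ... | inj₁ y∈as         = ∈-++⁺ˡ y∈as
    ... | inj₂ (here refl)  = contradiction refl (All.lookup x∉xs y∈xs)
    ... | inj₂ (there y∈bs) = ∈-++⁺ʳ as y∈bs

  sum-map-≥ : ∀ (g : A → ℕ) c {xs} → All (λ x → c ≤ g x) xs → length xs * c ≤ sum (map g xs)
  sum-map-≥ g c []         = z≤n
  sum-map-≥ g c (c≤ ∷ c≤s) = +-mono-≤ c≤ (sum-map-≥ g c c≤s)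

  sum-map-≤ : ∀ (g : A → ℕ) c → (∀ x → g x ≤ c) → ∀ xs → sum (map g xs) ≤ length xs * c
  sum-map-≤ g c g≤c []       = z≤n
  sum-map-≤ g c g≤c (x ∷ xs) = +-mono-≤ (g≤c x) (sum-map-≤ g c g≤c xs)

  sum-map-+ : ∀ (f g h : A → ℕ) → (∀ x → f x ≡ g x + h x) → ∀ xs →
    sum (map f xs) ≡ sum (map g xs) + sum (map h xs)
  sum-map-+ f g h f≡g+h []       = refl
  sum-map-+ f g h f≡g+h (x ∷ xs)
    rewrite f≡g+h x | sum-map-+ f g h f≡g+h xs =
    interchange (g x) (h x) (sum (map g xs)) (sum (map h xs))
    where
    interchange : ∀ a b c d → a + b + (c + d) ≡ a + c + (b + d)
    interchange = solve-∀

-- Cardinalities of finite subsets.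

∣p∪q∣≤∣p∣+∣q∣ : ∀ {n} (p q : Subset n) → ∣ p ∪ q ∣ ≤ ∣ p ∣ + ∣ q ∣
∣p∪q∣≤∣p∣+∣q∣ [] [] = z≤n
∣p∪q∣≤∣p∣+∣q∣ (outside ∷ p) (outside ∷ q) = ∣p∪q∣≤∣p∣+∣q∣ p q
∣p∪q∣≤∣p∣+∣q∣ (outside ∷ p) (inside  ∷ q) =
  ≤-trans (s≤s (∣p∪q∣≤∣p∣+∣q∣ p q)) (≤-reflexive (sym (+-suc ∣ p ∣ ∣ q ∣)))
∣p∪q∣≤∣p∣+∣q∣ (inside  ∷ p) (outside ∷ q) = s≤s (∣p∪q∣≤∣p∣+∣q∣ p q)
∣p∪q∣≤∣p∣+∣q∣ (inside  ∷ p) (inside  ∷ q) =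
  s≤s (≤-trans (∣p∪q∣≤∣p∣+∣q∣ p q) (+-monoʳ-≤ ∣ p ∣ (n≤1+n ∣ q ∣)))

∣p∣>0⇒Nonempty : ∀ {n} (p : Subset n) → 0 < ∣ p ∣ → Nonempty p
∣p∣>0⇒Nonempty (outside ∷ p) 0<∣p∣ =
  let x , x∈p = ∣p∣>0⇒Nonempty p 0<∣p∣ in suc x , Vec.there x∈p
∣p∣>0⇒Nonempty (inside  ∷ p) _ = zero , Vec.here

∣p∣>1⇒twoElements : ∀ {n} (p : Subset n) → 1 < ∣ p ∣ → ∃₂ λ x y → x ∈ₛ p × y ∈ₛ p × x ≢ y
∣p∣>1⇒twoElements (outside ∷ p) 1<∣p∣ =
  let x , y , x∈p , y∈p , x≢y = ∣p∣>1⇒twoElements p 1<∣p∣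
  in suc x , suc y , Vec.there x∈p , Vec.there y∈p , x≢y ∘ Finₚ.suc-injective
∣p∣>1⇒twoElements (inside  ∷ p) (s≤s 0<∣p∣) =
  let x , x∈p = ∣p∣>0⇒Nonempty p 0<∣p∣ in zero , suc x , Vec.here , Vec.there x∈p , λ ()

-- Elements of `q` outside `p` are discarded as long as at least `k` elements of `q` remain.
⊆-interpolate : ∀ {n k} {p q : Subset n} → p ⊆ q → ∣ p ∣ ≤ k → k ≤ ∣ q ∣ →
  ∃ λ r → p ⊆ r × r ⊆ q × ∣ r ∣ ≡ k
⊆-interpolate {p = []} {[]} p⊆q _ z≤n = [] , p⊆q , ⊆-refl , refl
⊆-interpolate {p = outside ∷ p} {outside ∷ q} p⊆q ∣p∣≤k k≤∣q∣ =
  let r , p⊆r , r⊆q , e = ⊆-interpolate (drop-∷-⊆ p⊆q) ∣p∣≤k k≤∣q∣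
  in outside ∷ r , s⊆s p⊆r , s⊆s r⊆q , e
⊆-interpolate {p = inside ∷ p} {inside ∷ q} p⊆q (s≤s ∣p∣≤k) (s≤s k≤∣q∣) =
  let r , p⊆r , r⊆q , e = ⊆-interpolate (drop-∷-⊆ p⊆q) ∣p∣≤k k≤∣q∣
  in inside ∷ r , s⊆s p⊆r , s⊆s r⊆q , cong suc e
⊆-interpolate {p = inside ∷ p} {outside ∷ q} p⊆q _ _ with () ← p⊆q Vec.here
⊆-interpolate {k = k} {p = outside ∷ p} {inside ∷ q} p⊆q ∣p∣≤k k≤1+∣q∣ with k ≤? ∣ q ∣
... | yes k≤∣q∣ =
  let r , p⊆r , r⊆q , e = ⊆-interpolate (drop-∷-⊆ p⊆q) ∣p∣≤k k≤∣q∣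
  in outside ∷ r , s⊆s p⊆r , out⊆ r⊆q , e
-- Here `k` is exactly one more than the size of the tail, so all of the larger set is taken.
... | no  k≰∣q∣ = inside ∷ q , p⊆q , ⊆-refl , ≤-antisym (≰⇒> k≰∣q∣) k≤1+∣q∣

-- Counting k-sets, and k-sets containing a given set.

private variable
  n k : ℕ

_≟ₖ_ : DecidableEquality (KSubset n k)
x ≟ₖ y = map′ KSubset-≡ (cong proj₁) (≡-dec _≟ᵇ_ (proj₁ x) (proj₁ y))

-- These are the sets obtained from `T` by adding one outside element. The size index `suc ∣ T ∣`
-- lets the recursion typecheck without transport.
supersets : (T : Subset n) → List (KSubset n (suc ∣ T ∣))
supersets []            = []
supersets (outside ∷ T) = keep (T , refl) ∷ map skip (supersets T)
supersets (inside  ∷ T) = map keep (supersets T)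

length-supersets : (T : Subset n) → length (supersets T) + ∣ T ∣ ≡ n
length-supersets []            = refl
length-supersets (outside ∷ T) =
  cong suc (trans (cong (_+ ∣ T ∣) (length-map skip (supersets T))) (length-supersets T))
length-supersets (inside  ∷ T) = trans (+-suc _ _)
  (cong suc (trans (cong (_+ ∣ T ∣) (length-map keep (supersets T))) (length-supersets T)))

supersets-unique : (T : Subset n) → Unique (supersets T)
supersets-unique []            = []
supersets-unique (outside ∷ T) =
  All.tabulate keep≢ ∷ map⁺ skip-injective (supersets-unique T)
  where
  keep≢ : ∀ {v} → v ∈ map skip (supersets T) → keep (T , refl) ≢ v
  keep≢ v∈ eq with _ , _ , refl ← ∈-map⁻ skip v∈ with () ← cong proj₁ eq
supersets-unique (inside  ∷ T) = map⁺ keep-injective (supersets-unique T)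

supersets-⊇ : (T : Subset n) → All (λ v → T ⊆ proj₁ v) (supersets T)
supersets-⊇ []            = []
supersets-⊇ (outside ∷ T) = out⊆ ⊆-refl ∷ Allₚ.map⁺ (All.map s⊆s (supersets-⊇ T))
supersets-⊇ (inside  ∷ T) = Allₚ.map⁺ (All.map s⊆s (supersets-⊇ T))

-- Replaces the index `suc ∣ T ∣` by any `k` equal to it, so that the family consists of vertices of
-- the given Kneser graph.
supersetFamily : (T : Subset n) → suc ∣ T ∣ ≡ k → ∃ λ (F : List (KSubset n k)) →
  Unique F × All (λ v → T ⊆ proj₁ v) F × length F + ∣ T ∣ ≡ n
supersetFamily T refl = supersets T , supersets-unique T , supersets-⊇ T , length-supersets T

length-kSubsets-suc : ∀ n k → length (kSubsets (suc n) (suc k)) ≡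
  length (kSubsets n (suc k)) + length (kSubsets n k)
length-kSubsets-suc n k
  rewrite length-++ (map skip (kSubsets n (suc k))) {map keep (kSubsets n k)}
        | length-map skip (kSubsets n (suc k)) | length-map keep (kSubsets n k) = refl

length-kSubsets-≥1 : k ≤ n → 1 ≤ length (kSubsets n k)
length-kSubsets-≥1 {n = zero}  z≤n = ≤-refl
length-kSubsets-≥1 {n = suc n} z≤n = subst (1 ≤_)
  (sym (length-map skip (kSubsets n 0))) (length-kSubsets-≥1 {n = n} z≤n)
length-kSubsets-≥1 {n = suc n} (s≤s {k} k≤n) rewrite length-kSubsets-suc n k =
  m≤n⇒m≤o+n (length (kSubsets n (suc k))) (length-kSubsets-≥1 k≤n)

-- Induction along Pascal's rule: of the two summands, one is at least `n` by induction and the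
-- other at least 1. Which one is which depends on whether the larger subset size equals `n`.
length-kSubsets-≥n : 0 < k → k < n → n ≤ length (kSubsets n k)
length-kSubsets-≥n {suc k} {suc n} _ (s≤s k<n)
  rewrite length-kSubsets-suc n k with k | suc k ≟ n
... | k | no  1+k≢n =
  ≤-trans (≤-reflexive (+-comm 1 n))
    (+-mono-≤ (length-kSubsets-≥n z<s (≤∧≢⇒< k<n 1+k≢n)) (length-kSubsets-≥1 (<⇒≤ k<n)))
... | zero  | yes refl = ≤-refl
... | suc k | yes refl =
  +-mono-≤ (length-kSubsets-≥1 {k = suc (suc k)} ≤-refl) (length-kSubsets-≥n z<s ≤-refl)

-- Hitting sets.

_Hits_ : Subset n → KSubset n k → Set
T Hits v = Nonempty (T ∩ proj₁ v)

Hits-⊆ : ∀ {T U : Subset n} → T ⊆ U → (v : KSubset n k) → T Hits v → U Hits v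
Hits-⊆ {T = T} {U} T⊆U (p , _) (x , x∈) =
  let x∈T , x∈p = x∈p∩q⁻ T p x∈ in x , x∈p∩q⁺ (T⊆U x∈T , x∈p)

HitsAll : Subset n → List (KSubset n k) → Set
HitsAll T = All (T Hits_)

HitsAll-⊆ : ∀ {T U : Subset n} → T ⊆ U → {L : List (KSubset n k)} → HitsAll T L → HitsAll U L
HitsAll-⊆ T⊆U = All.map (λ {v} → Hits-⊆ T⊆U v)

addPoint : ∀ {x} (T : Subset n) (v : KSubset n k) {L} → x ∈ₛ proj₁ v → HitsAll T L →
  HitsAll (⁅ x ⁆ ∪ T) (v ∷ L)
addPoint {x = x} T v x∈v hits =
  (x , x∈p∩q⁺ (x∈p∪q⁺ (inj₁ (x∈⁅x⁆ x)) , x∈v)) ∷ HitsAll-⊆ (q⊆p∪q ⁅ x ⁆ T) hits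

∣⁅x⁆∪p∣≤1+∣p∣ : ∀ x (p : Subset n) → ∣ ⁅ x ⁆ ∪ p ∣ ≤ suc ∣ p ∣
∣⁅x⁆∪p∣≤1+∣p∣ x p = ≤-trans (∣p∪q∣≤∣p∣+∣q∣ ⁅ x ⁆ p) (≤-reflexive (cong (_+ ∣ p ∣) (∣⁅x⁆∣≡1 x)))

point : .{{_ : NonZero k}} (v : KSubset n k) → Nonempty (proj₁ v)
point {k} (p , e) = ∣p∣>0⇒Nonempty p (subst (0 <_) (sym e) (>-nonZero⁻¹ k))

hittingSet : .{{_ : NonZero k}} (L : List (KSubset n k)) → ∃ λ T → HitsAll T L × ∣ T ∣ ≤ length L
hittingSet {n = n} [] = ⊥ , [] , ≤-reflexive (∣⊥∣≡0 n)
hittingSet (v ∷ L)     =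
  let x , x∈v = point v
      T , hits , ∣T∣≤ = hittingSet L
  in ⁅ x ⁆ ∪ T , addPoint T v x∈v hits , ≤-trans (∣⁅x⁆∪p∣≤1+∣p∣ x T) (s≤s ∣T∣≤)

-- From a set containing `x` the point chosen is `x` itself, so passing through `x` costs no extra
-- element.
hittingSet-through : .{{_ : NonZero k}} → ∀ {x} {L : List (KSubset n k)} → Any (λ v → x ∈ₛ proj₁ v) L →
  ∃ λ T → x ∈ₛ T × HitsAll T L × ∣ T ∣ ≤ length L
hittingSet-through {x = x} {v ∷ L} (here x∈v) =
  let T , hits , ∣T∣≤ = hittingSet L
  in ⁅ x ⁆ ∪ T , x∈p∪q⁺ (inj₁ (x∈⁅x⁆ x)) , addPoint T v x∈v hits ,
     ≤-trans (∣⁅x⁆∪p∣≤1+∣p∣ x T) (s≤s ∣T∣≤)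
hittingSet-through {L = v ∷ L} (there x∈L) =
  let y , y∈v = point v
      T , x∈T , hits , ∣T∣≤ = hittingSet-through x∈L
  in ⁅ y ⁆ ∪ T , x∈p∪q⁺ (inj₂ x∈T) , addPoint T v y∈v hits ,
     ≤-trans (∣⁅x⁆∪p∣≤1+∣p∣ y T) (s≤s ∣T∣≤)

-- Pairwise disjoint families.

PairwiseDisjoint : List (KSubset n k) → Set
PairwiseDisjoint = AllPairs Disjoint

-- If `v` meets a member of `L` in `x`, a hitting set of `L` through `x` hits `v` as well, which
-- saves one element.
disjoint⊎smallHittingSet : .{{_ : NonZero k}} (L : List (KSubset n k)) →
  PairwiseDisjoint L ⊎ ∃ λ T → HitsAll T L × ∣ T ∣ < length L
disjoint⊎smallHittingSet []      = inj₁ []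
disjoint⊎smallHittingSet (v ∷ L) with disjoint⊎smallHittingSet L
... | inj₂ (T , hits , ∣T∣<) =
  let x , x∈v = point v
  in inj₂ (⁅ x ⁆ ∪ T , addPoint T v x∈v hits , s≤s (≤-trans (∣⁅x⁆∪p∣≤1+∣p∣ x T) ∣T∣<))
... | inj₁ disj with any? (λ w → nonempty? (proj₁ v ∩ proj₁ w)) L
...   | no  ¬meets = inj₁ (¬Any⇒All¬ L ¬meets ∷ disj)
...   | yes meets with w , w∈L , x , x∈v∩w ← find meets =
  let x∈v , x∈w = x∈p∩q⁻ (proj₁ v) (proj₁ w) x∈v∩w
      T , x∈T , hits , ∣T∣≤ = hittingSet-through (lose w∈L x∈w)
  in inj₂ (T , (x , x∈p∩q⁺ (x∈T , x∈v)) ∷ hits , s≤s ∣T∣≤)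

-- A member of L hitting all of L would meet another member.
hitting⇒∉ : ∀ {L : List (KSubset n k)} → PairwiseDisjoint L → 1 < length L →
  (u : KSubset n k) → HitsAll (proj₁ u) L → u ∉ L
hitting⇒∉ {L = _ ∷ []}    _ (s≤s ())
hitting⇒∉ {L = _ ∷ _ ∷ _} ((a#b ∷ _) ∷ _) _ u (_ ∷ hitsb ∷ _) (here refl) = a#b hitsb
hitting⇒∉ {L = a ∷ _ ∷ _} (a#L ∷ _) _ u (hitsa ∷ _) (there u∈L) =
  All.lookup a#L u∈L (subst Nonempty (∩-comm (proj₁ u) (proj₁ a)) hitsa)

-- A point of `T` in `v` lies in no later member, so removing it leaves a hitting set of the tail.
hitting⇒length≤ : ∀ {L : List (KSubset n k)} → PairwiseDisjoint L →
  (T : Subset n) → HitsAll T L → length L ≤ ∣ T ∣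
hitting⇒length≤ []           T []          = z≤n
hitting⇒length≤ {L = v ∷ L} (v#L ∷ disj) T ((x , x∈) ∷ hits) =
  ≤-trans (s≤s (hitting⇒length≤ disj (T - x) (All.tabulate hits′))) (x∈p⇒∣p-x∣<∣p∣ x∈T)
  where
  x∈T = proj₁ (x∈p∩q⁻ T (proj₁ v) x∈)
  x∈v = proj₂ (x∈p∩q⁻ T (proj₁ v) x∈)
  hits′ : ∀ {w} → w ∈ L → (T - x) Hits w
  hits′ {w} w∈L =
    let y , y∈ = All.lookup hits w∈L
        y∈T , y∈w = x∈p∩q⁻ T (proj₁ w) y∈
    in y , x∈p∩q⁺ (x∈p∧x≢y⇒x∈p-y y∈T (λ { refl → All.lookup v#L w∈L (x , x∈p∩q⁺ (x∈v , y∈w)) }) , y∈w)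

-- The set `U` contains all members chosen so far; the bound on its size leaves room for another
-- k-set in its complement.
disjointFamily : ∀ n k j → j * k ≤ n → ∃ λ (L : List (KSubset n k)) →
  length L ≡ j × PairwiseDisjoint L × ∃ λ U → ∣ U ∣ ≤ j * k × All (λ v → proj₁ v ⊆ U) L
disjointFamily n k zero    _     = [] , refl , [] , ⊥ , ≤-reflexive (∣⊥∣≡0 n) , []
disjointFamily n k (suc j) k+jk≤n
  with L , length≡ , disj , U , ∣U∣≤ , L⊆U ← disjointFamily n k j (m+n≤o⇒n≤o k k+jk≤n)
  with p , _ , p⊆∁U , ∣p∣≡k ← ⊆-interpolate {k = k} {p = ⊥} {q = ∁ U} ⊥⊆
         (≤-trans (≤-reflexive (∣⊥∣≡0 n)) z≤n)
         (subst (k ≤_) (sym (∣∁p∣≡n∸∣p∣ U))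
           (≤-trans (m+n≤o⇒m≤o∸n k k+jk≤n) (∸-monoʳ-≤ n ∣U∣≤)))
  = (p , ∣p∣≡k) ∷ L , cong suc length≡ , All.tabulate (λ {v} v∈L → p# v (All.lookup L⊆U v∈L)) ∷ disj , p ∪ U ,
    ≤-trans (∣p∪q∣≤∣p∣+∣q∣ p U) (+-mono-≤ (≤-reflexive ∣p∣≡k) ∣U∣≤) ,
    p⊆p∪q U ∷ All.tabulate (λ v∈L x∈v → q⊆p∪q p U (All.lookup L⊆U v∈L x∈v))
  where
  p# : ∀ v → proj₁ v ⊆ U → Disjoint (p , ∣p∣≡k) v
  p# v v⊆U (x , x∈) =
    let x∈p , x∈v = x∈p∩q⁻ p (proj₁ v) x∈ in x∈∁p⇒x∉p (p⊆∁U x∈p) (v⊆U x∈v)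

-- Lower bound for the weight of an arbitrary Roman domination function.

module LowerBound (n k : ℕ) .{{_ : NonZero n}} .{{_ : NonZero k}}
  (k>1 : k > 1) (n≥ : n ≥ k * (k + 1))
  (f : KSubset n k → Fin 3) (rdf : IsRDF (Kneser n k) f) where

  private
    G = Kneser n k

  3k≤n : k * 3 ≤ n
  3k≤n = ≤-trans (*-monoʳ-≤ k (subst (3 ≤_) (+-comm 1 k) (s≤s k>1))) n≥

  k≤n : k ≤ n
  k≤n = ≤-trans (m≤m*n k 3) 3k≤n

  2[k+1]≤n : 2 * (k + 1) ≤ n
  2[k+1]≤n = ≤-trans (*-monoˡ-≤ (k + 1) k>1) n≥

  valueTwo : List (KSubset n k)
  valueTwo = filter (λ v → f v ≟ᶠ 2F) (kSubsets n k)

  valueTwo-unique : Unique valueTwo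
  valueTwo-unique = filter⁺ (λ v → f v ≟ᶠ 2F) (kSubsets-unique n k)

  valueTwo-value : All (λ v → f v ≡ 2F) valueTwo
  valueTwo-value = Allₚ.all-filter (λ v → f v ≟ᶠ 2F) (kSubsets n k)

  -- A vertex of value 0 has a neighbor of value 2, that is, a disjoint set in `valueTwo`, which it
  -- then fails to hit.
  hitting⇒positive : ∀ v → HitsAll (proj₁ v) valueTwo → 1 ≤ toℕ (f v)
  hitting⇒positive v hits with f v in fv≡
  ... | suc _ = s≤s z≤n
  ... | 0F with u , v#u , fu≡2 ← rdf v fv≡ =
    ⊥-elim (v#u (All.lookup hits
      (∈-filter⁺ (λ v → f v ≟ᶠ 2F) (kSubsets-complete n k u) fu≡2)))

  partialSum≤ : ∀ (g : KSubset n k → ℕ) {xs} → Unique xs →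
    sum (map g xs) ≤ sum (map g (kSubsets n k))
  partialSum≤ g uniq = sum-support-≤ g (kSubsets n k) uniq (λ {x} _ _ → kSubsets-complete n k x)

  valueTwo-sum : length valueTwo * 2 ≤ sum (map (toℕ ∘ f) valueTwo)
  valueTwo-sum = sum-map-≥ (toℕ ∘ f) 2
    (All.map (λ fv≡2 → ≤-reflexive (cong toℕ (sym fv≡2))) valueTwo-value)

  weight≥2∣valueTwo∣ : length valueTwo * 2 ≤ weight G f
  weight≥2∣valueTwo∣ = ≤-trans valueTwo-sum (partialSum≤ (toℕ ∘ f) valueTwo-unique)

  -- Each value `i` splits as `i ⊓ 1` plus `i ∸ 1`: the first part counts the members of `F`, the
  -- second those of `valueTwo`. Thus `F` and `valueTwo` may overlap.
  weight≥positive+∣valueTwo∣ : ∀ {F} → Unique F → All (λ v → 1 ≤ toℕ (f v)) F →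
    length F + length valueTwo ≤ weight G f
  weight≥positive+∣valueTwo∣ {F} F-unique F-positive = begin
    length F + length valueTwo          ≡⟨ +-cong-*1 ⟨
    length F * 1 + length valueTwo * 1  ≤⟨ +-mono-≤ F-sum two-sum ⟩
    sum (map isPos (kSubsets n k)) + sum (map isTwo (kSubsets n k))
      ≡⟨ sum-map-+ (toℕ ∘ f) isPos isTwo (λ v → split (f v)) (kSubsets n k) ⟨
    weight G f                          ∎
    where
    open ≤-Reasoning
    isPos isTwo : KSubset n k → ℕ
    isPos v = toℕ (f v) ⊓ 1
    isTwo v = toℕ (f v) ∸ 1
    split : ∀ (i : Fin 3) → toℕ i ≡ toℕ i ⊓ 1 + (toℕ i ∸ 1)
    split 0F = refl
    split 1F = refl
    split 2F = refl
    +-cong-*1 : length F * 1 + length valueTwo * 1 ≡ length F + length valueTwo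
    +-cong-*1 rewrite *-identityʳ (length F) | *-identityʳ (length valueTwo) = refl
    F-sum : length F * 1 ≤ sum (map isPos (kSubsets n k))
    F-sum = ≤-trans (sum-map-≥ isPos 1 (All.map (λ 1≤ → ⊓-glb 1≤ ≤-refl) F-positive))
                    (partialSum≤ isPos F-unique)
    two-sum : length valueTwo * 1 ≤ sum (map isTwo (kSubsets n k))
    two-sum = ≤-trans
      (sum-map-≥ isTwo 1
        (All.map (λ fv≡2 → ≤-reflexive (cong (λ i → toℕ i ∸ 1) (sym fv≡2))) valueTwo-value))
      (partialSum≤ isTwo valueTwo-unique)

  -- All vertices are positive, and there are at least `n` of them, where `n` is at least
  -- `k * (k + 1)` and `k` at least 2.
  valueTwoEmpty : length valueTwo ≡ 0 → 2 * (k + 1) ≤ weight G f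
  valueTwoEmpty none = begin
    2 * (k + 1)                                ≤⟨ 2[k+1]≤n ⟩
    n                                          ≤⟨ length-kSubsets-≥n (<⇒≤ k>1) k<n ⟩
    length (kSubsets n k)                      ≤⟨ m≤m+n _ _ ⟩
    length (kSubsets n k) + length valueTwo    ≤⟨ weight≥positive+∣valueTwo∣ (kSubsets-unique n k)
                                                    (All.tabulate λ {v} _ → hitting⇒positive v (vacuous valueTwo none)) ⟩
    weight G f                                 ∎
    where
    open ≤-Reasoning
    k<n : k < n
    k<n = ≤-trans (≤-trans (≤-reflexive (+-comm 1 k)) (m≤n*m (k + 1) 2)) 2[k+1]≤n
    vacuous : ∀ {T} (L : List (KSubset n k)) → length L ≡ 0 → HitsAll T L
    vacuous [] _ = []

  smallHittingSet : ∀ T → HitsAll T valueTwo → ∣ T ∣ < k → 0 < length valueTwo →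
    2 * (k + 1) ≤ weight G f
  smallHittingSet T hits ∣T∣<k nonempty =
    let T′ , T⊆T′ , _ , ∣T′∣≡k-1 = ⊆-interpolate {k = pred k} (λ _ → ∈⊤) (pred-mono-≤ ∣T∣<k)
          (subst (pred k ≤_) (sym (∣⊤∣≡n n)) (≤-trans pred[n]≤n k≤n))
        1+∣T′∣≡k = trans (cong suc ∣T′∣≡k-1) (suc-pred k)
        F , F-unique , T′⊆F , length-F = supersetFamily T′ 1+∣T′∣≡k
    in ≤-trans
      -- Adding `suc ∣ T′ ∣`, which equals `k`, to both sides avoids subtraction: the claim becomes
      -- `3k + 2 ≤ n + 1 + m` with `m` the length of `valueTwo`, and this follows from `3k ≤ n` and
      -- `m ≥ 1`.
      (+-cancelʳ-≤ (suc ∣ T′ ∣) (2 * (k + 1)) (length F + length valueTwo) (begin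
        2 * (k + 1) + suc ∣ T′ ∣                ≡⟨ cong (2 * (k + 1) +_) 1+∣T′∣≡k ⟩
        2 * (k + 1) + k                         ≡⟨ rearrange₁ k ⟩
        k * 3 + 2                               ≤⟨ +-mono-≤ 3k≤n (s≤s nonempty) ⟩
        n + suc (length valueTwo)               ≡⟨ cong (_+ suc (length valueTwo)) length-F ⟨
        length F + ∣ T′ ∣ + suc (length valueTwo) ≡⟨ rearrange₂ (length F) ∣ T′ ∣ (length valueTwo) ⟩
        length F + length valueTwo + suc ∣ T′ ∣ ∎))
      (weight≥positive+∣valueTwo∣ F-unique
        (All.map (λ {v} T′⊆v → hitting⇒positive v (HitsAll-⊆ (λ x∈T → T′⊆v (T⊆T′ x∈T)) hits)) T′⊆F))
    where
    open ≤-Reasoning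
    rearrange₁ : ∀ k → 2 * (k + 1) + k ≡ k * 3 + 2
    rearrange₁ = solve-∀
    rearrange₂ : ∀ a b c → a + b + suc c ≡ a + c + suc b
    rearrange₂ = solve-∀

  disjointValueTwo : length valueTwo ≡ k → PairwiseDisjoint valueTwo →
    2 * (k + 1) ≤ weight G f
  disjointValueTwo length≡k disj with valueTwo in eq
  ... | [] = contradiction (subst (_> 1) (sym length≡k) k>1) λ ()
  ... | v ∷ L
    with x , y , x∈v , y∈v , x≢y ← ∣p∣>1⇒twoElements (proj₁ v) (subst (_> 1) (sym (proj₂ v)) k>1)
       | T , hits , ∣T∣≤ ← hittingSet L
    -- Both unions hit all of `valueTwo` and have at most `k` elements. One of size other than `k`
    -- is a small hitting set; otherwise both are vertices.
    = transversals (∣ ⁅ x ⁆ ∪ T ∣ ≟ k) (∣ ⁅ y ⁆ ∪ T ∣ ≟ k)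
    where
    open ≤-Reasoning

    hits-valueTwo : ∀ {z} → z ∈ₛ proj₁ v → HitsAll (⁅ z ⁆ ∪ T) valueTwo
    hits-valueTwo z∈v = subst (HitsAll _) (sym eq) (addPoint T v z∈v hits)

    ∣T∣<k : ∣ T ∣ < k
    ∣T∣<k = ≤-trans (s≤s ∣T∣≤) (≤-reflexive length≡k)

    tooSmall : ∀ {z} → z ∈ₛ proj₁ v → ∣ ⁅ z ⁆ ∪ T ∣ ≢ k → 2 * (k + 1) ≤ weight G f
    tooSmall {z} z∈v ≢k = smallHittingSet (⁅ z ⁆ ∪ T) (hits-valueTwo z∈v)
      (≤∧≢⇒< (≤-trans (∣⁅x⁆∪p∣≤1+∣p∣ z T) ∣T∣<k) ≢k)
      (subst (λ L → 0 < length L) (sym eq) z<s)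

    transversals : Dec (∣ ⁅ x ⁆ ∪ T ∣ ≡ k) → Dec (∣ ⁅ y ⁆ ∪ T ∣ ≡ k) → 2 * (k + 1) ≤ weight G f
    transversals (no ≢k) _       = tooSmall x∈v ≢k
    transversals (yes _) (no ≢k) = tooSmall y∈v ≢k
    transversals (yes ∣x∪T∣≡k) (yes ∣y∪T∣≡k) = begin
      2 * (k + 1)                                          ≡⟨ *-comm 2 (k + 1) ⟩
      (k + 1) * 2                                          ≡⟨ cong (_* 2) (+-comm k 1) ⟩
      1 + (1 + k * 2)                                      ≡⟨ cong (λ m → 1 + (1 + m * 2)) length≡k ⟨
      1 + (1 + length (v ∷ L) * 2)                         ≡⟨ cong (λ L → 1 + (1 + length L * 2)) eq ⟨
      1 + (1 + length valueTwo * 2)                        ≤⟨ +-mono-≤ (positive a x∈v refl)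
                                                                (+-mono-≤ (positive b y∈v refl) valueTwo-sum) ⟩
      sum (map (toℕ ∘ f) (a ∷ b ∷ valueTwo))               ≤⟨ partialSum≤ (toℕ ∘ f)
                                                                ((a≢b ∷ ≢valueTwo a x∈v refl) ∷ ≢valueTwo b y∈v refl ∷ valueTwo-unique) ⟩
      weight G f                                           ∎
      where
      a b : KSubset n k
      a = ⁅ x ⁆ ∪ T , ∣x∪T∣≡k
      b = ⁅ y ⁆ ∪ T , ∣y∪T∣≡k

      positive : ∀ {z} (u : KSubset n k) → z ∈ₛ proj₁ v → proj₁ u ≡ ⁅ z ⁆ ∪ T → 1 ≤ toℕ (f u)
      positive u z∈v refl = hitting⇒positive u (hits-valueTwo z∈v)

      ≢valueTwo : ∀ {z} (u : KSubset n k) → z ∈ₛ proj₁ v → proj₁ u ≡ ⁅ z ⁆ ∪ T →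
        All (u ≢_) valueTwo
      ≢valueTwo u z∈v refl = subst (All (u ≢_)) (sym eq) (¬Any⇒All¬ (v ∷ L)
        (hitting⇒∉ disj (subst (_> 1) (sym length≡k) k>1) u (addPoint T v z∈v hits)))

      -- Otherwise adding `x` would leave `T` unchanged, with fewer than `k` elements.
      x∉T : ¬ x ∈ₛ T
      x∉T x∈T = <⇒≢ ∣T∣<k (≤-antisym (<⇒≤ ∣T∣<k) (subst (_≤ ∣ T ∣) ∣x∪T∣≡k
        (p⊆q⇒∣p∣≤∣q∣ λ z∈ → [ (λ z∈x → subst (_∈ₛ T) (sym (x∈⁅y⁆⇒x≡y x z∈x)) x∈T) , id ]′
          (x∈p∪q⁻ ⁅ x ⁆ T z∈))))

      a≢b : a ≢ b
      a≢b a≡b = [ x≢y ∘ x∈⁅y⁆⇒x≡y y , x∉T ]′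
        (x∈p∪q⁻ ⁅ y ⁆ T (subst (x ∈ₛ_) (cong proj₁ a≡b) (x∈p∪q⁺ (inj₁ (x∈⁅x⁆ x)))))

  lowerBound : 2 * (k + 1) ≤ weight G f
  lowerBound with length valueTwo ≤? k
  ... | no m≰k = begin
    2 * (k + 1)          ≡⟨ *-comm 2 (k + 1) ⟩
    (k + 1) * 2          ≡⟨ cong (_* 2) (+-comm k 1) ⟩
    suc k * 2            ≤⟨ *-monoˡ-≤ 2 (≰⇒> m≰k) ⟩
    length valueTwo * 2  ≤⟨ weight≥2∣valueTwo∣ ⟩
    weight G f           ∎
    where open ≤-Reasoning
  ... | yes m≤k with length valueTwo ≟ 0
  ...   | yes m≡0 = valueTwoEmpty m≡0
  ...   | no  m≢0 with disjoint⊎smallHittingSet valueTwo | length valueTwo ≟ k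
  ...     | inj₂ (T , hits , ∣T∣<m) | _ =
    smallHittingSet T hits (≤-trans ∣T∣<m m≤k) (n≢0⇒n>0 m≢0)
  ...     | inj₁ disj | yes m≡k = disjointValueTwo m≡k disj
  -- With fewer than `k` sets of value 2, one point from each already gives a small hitting set.
  ...     | inj₁ _    | no  m≢k =
    let T , hits , ∣T∣≤m = hittingSet valueTwo
    in smallHittingSet T hits (≤-trans (s≤s ∣T∣≤m) (≤∧≢⇒< m≤k m≢k)) (n≢0⇒n>0 m≢0)

-- Upper bound and the exact value.

corollary1 : (n k : ℕ) .{{_ : NonZero n}} .{{_ : NonZero k}} →
    k > 1 → n ≥ k * (k + 1) →
    IsRomanDominationNumber (Kneser n k) (2 * (k + 1))
corollary1 n k k>1 n≥ =
  -- Only an upper bound for the weight of `f` is computed; equality comes from the lower bound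
  -- applied to `f` itself.
  (f , f-rdf , ≤-antisym weight≤ (LowerBound.lowerBound n k k>1 n≥ f f-rdf)) ,
  LowerBound.lowerBound n k k>1 n≥
  where
  family = disjointFamily n k (k + 1) (subst (_≤ n) (*-comm k (k + 1)) n≥)
  L = proj₁ family
  length-L : length L ≡ k + 1
  length-L = proj₁ (proj₂ family)
  L-disjoint : PairwiseDisjoint L
  L-disjoint = proj₁ (proj₂ (proj₂ family))
  value : ∀ {v} → Dec (v ∈ L) → Fin 3
  value (yes _) = 2F
  value (no  _) = 0F
  f : KSubset n k → Fin 3
  f v = value (member? _≟ₖ_ v L)
  f≡2 : ∀ {v} → v ∈ L → f v ≡ 2F
  f≡2 {v} v∈L with member? _≟ₖ_ v L
  ... | yes _   = refl
  ... | no  v∉L = contradiction v∈L v∉L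
  f-support : ∀ {v} → toℕ (f v) ≢ 0 → v ∈ L
  f-support {v} fv≢0 with member? _≟ₖ_ v L
  ... | yes v∈L = v∈L
  ... | no  _   = contradiction refl fv≢0
  f-rdf : IsRDF (Kneser n k) f
  f-rdf (p , ∣p∣≡k) _ with any? (λ w → ¬? (nonempty? (p ∩ proj₁ w))) L
  ... | yes p#L = let u , u∈L , p#u = find p#L in u , p#u , f≡2 u∈L
  -- Otherwise `p` would hit `k + 1` pairwise disjoint sets and so have at least `k + 1` elements.
  ... | no ¬p#L = contradiction
    (subst (_≤ k) (trans length-L (+-comm k 1)) (subst (length L ≤_) ∣p∣≡k
      (hitting⇒length≤ L-disjoint p
        (All.map (λ {w} → decidable-stable (nonempty? (p ∩ proj₁ w)))
          (¬Any⇒All¬ L ¬p#L)))))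
    1+n≰n
  weight≤ : weight (Kneser n k) f ≤ 2 * (k + 1)
  weight≤ = begin
    weight (Kneser n k) f   ≤⟨ sum-support-≤ (toℕ ∘ f) L (kSubsets-unique n k) (λ _ → f-support) ⟩
    sum (map (toℕ ∘ f) L)   ≤⟨ sum-map-≤ (toℕ ∘ f) 2 (λ v → toℕ≤pred[n] (f v)) L ⟩
    length L * 2            ≡⟨ cong (_* 2) length-L ⟩
    (k + 1) * 2             ≡⟨ *-comm (k + 1) 2 ⟩
    2 * (k + 1)             ∎
    where open ≤-Reasoning
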